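{- Let $f$ be Riemann-integrable on the interval $[a,b]$ such that $f$ is continuous from the left at every integer $n$ with $a<n\le b$. Then $$\sum_{a<n\le b}f(n)=\int_a^b f(u)\,du+\int_a^b\Big(u-[u]-\frac12\Big)df(u)+f(a)\Big(a-[a]-\frac12\Big)-f(b)\Big(b-[b]-\frac12\Big).$$
   Context: $[x]$ denotes the integral part of the real number $x$; the sum runs over integers $n$. The integral with respect to $df$ is a Riemann–Stieltjes integral. -}

module Defs where

open import Algebra.Bundles using (CommutativeRing)
open import Data.Integer.Base as ℤ using (ℤ; +_; -[1+_])
import Data.Integer.Properties as ℤ
open import Data.List.Base using (List; []; _∷_; map; foldr; filter; applyUpTo)
open import Data.List.Membership.Propositional using (_∈_)
open import Data.List.Membership.Propositional.Properties
  using (∈-filter⁺; ∈-filter⁻; ∈-applyUpTo⁺)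
import Data.List.Relation.Binary.Subset.Setoid as Subset
open import Data.List.Relation.Unary.Unique.Propositional using (Unique)
import Data.List.Relation.Unary.Unique.Propositional.Properties as Unique
open import Data.Nat.Base as ℕ using (ℕ; zero; suc; s≤s)
import Data.Nat.Properties as ℕ
open import Data.Product.Base using (∃; _×_; _,_; proj₁; proj₂)
open import Data.Sum.Base using (inj₁; inj₂)
open import Function.Bundles using (_⇔_; mk⇔)
open import Level using (_⊔_) renaming (suc to lsuc)
open import Relation.Binary.Bundles using (StrictTotalOrder)
open import Relation.Binary.Core using (Rel; _Preserves_⟶_)
open import Relation.Binary.Definitions using (tri<; tri≈; tri>)
open import Relation.Binary.PropositionalEquality as ≡ using (_≡_)
open import Relation.Binary.Structures using (IsStrictTotalOrder)
open import Relation.Nullary using (Dec; yes; no; contradiction)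
open import Relation.Nullary.Decidable using (_×-dec_)

import Algebra.Definitions.RawMonoid as RawMonoidMult
import Algebra.Properties.Ring as RingProperties
import Relation.Binary.Construct.StrictToNonStrict as StrictToNonStrict
import Relation.Binary.Properties.StrictTotalOrder as StrictTotalOrderProperties
import Relation.Binary.Reasoning.Setoid as SetoidReasoning

------------------------------------------------------------------------
record OrderedField c ℓ₁ ℓ₂ : Set (lsuc (c ⊔ ℓ₁ ⊔ ℓ₂)) where
  field
    commutativeRing : CommutativeRing c ℓ₁

  open CommutativeRing commutativeRing public

  infix 4 _<_
  infix 9 _⁻¹

  field
    _<_                : Rel Carrier ℓ₂
    isStrictTotalOrder : IsStrictTotalOrder _≈_ _<_
    0≉1                : 0# ≉ 1#
    -- The value of 0# ⁻¹ is unspecified.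
    _⁻¹                : Carrier → Carrier
    ⁻¹-cong            : _⁻¹ Preserves _≈_ ⟶ _≈_
    ⁻¹-inverseʳ        : ∀ {x} → x ≉ 0# → x * x ⁻¹ ≈ 1#
    +-monoˡ-<          : ∀ z {x y} → x < y → x + z < y + z
    *-pos              : ∀ {x y} → 0# < x → 0# < y → 0# < x * y

  strictTotalOrder : StrictTotalOrder c ℓ₁ ℓ₂
  strictTotalOrder = record { isStrictTotalOrder = isStrictTotalOrder }

  open IsStrictTotalOrder isStrictTotalOrder public
    using (compare; _<?_; _≟_; <-resp-≈; <-respˡ-≈; <-respʳ-≈)
    renaming (trans to <-trans; irrefl to <-irrefl; asym to <-asym)

  open StrictToNonStrict _≈_ _<_ public using (_≤_)

  open StrictTotalOrderProperties strictTotalOrder public using (_≤?_)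

  infixr 8 _·_
  _·_ : ℕ → Carrier → Carrier
  _·_ = RawMonoidMult._×_ +-rawMonoid

  ∣_∣ : Carrier → Carrier
  ∣ x ∣ with x <? 0#
  ... | yes _ = - x
  ... | no  _ = x

  Cauchy : (ℕ → Carrier) → Set (c ⊔ ℓ₂)
  Cauchy s = ∀ ε → 0# < ε →
    ∃ λ N → ∀ m n → N ℕ.≤ m → N ℕ.≤ n → ∣ s m - s n ∣ < ε

  ConvergesTo : (ℕ → Carrier) → Carrier → Set (c ⊔ ℓ₂)
  ConvergesTo s l = ∀ ε → 0# < ε →
    ∃ λ N → ∀ n → N ℕ.≤ n → ∣ s n - l ∣ < ε

-- The real numbers, characterised up to isomorphism (in classical
-- mathematics) as the Cauchy-complete Archimedean ordered field.  The
-- order is trichotomous, hence decidable: this is the classical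
-- continuum, on which the integral part is an everywhere defined function.

record RealField c ℓ₁ ℓ₂ : Set (lsuc (c ⊔ ℓ₁ ⊔ ℓ₂)) where
  field
    orderedField : OrderedField c ℓ₁ ℓ₂

  open OrderedField orderedField public

  field
    archimedean : ∀ x → ∃ λ n → x < n · 1#
    complete    : ∀ s → Cauchy s → ∃ λ l → ConvergesTo s l

------------------------------------------------------------------------

module RealAnalysis {c ℓ₁ ℓ₂} (R : RealField c ℓ₁ ℓ₂) where

  open RealField R
  open RingProperties ring using (-‿involutive; -‿+-comm; -0#≈0#)

  ½ : Carrier
  ½ = (1# + 1#) ⁻¹

  fromℤ : ℤ → Carrier
  fromℤ (+ n)    = n · 1#
  fromℤ -[1+ n ] = - (suc n · 1#)

  ----------------------------------------------------------------------
  -- Integral part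

  private
    -‿suc : ∀ y → - (1# + y) + 1# ≈ - y
    -‿suc y = begin
      - (1# + y) + 1#      ≈⟨ +-congʳ (-‿+-comm 1# y) ⟨
      (- 1# + - y) + 1#    ≈⟨ +-congʳ (+-comm (- 1#) (- y)) ⟩
      (- y + - 1#) + 1#    ≈⟨ +-assoc (- y) (- 1#) 1# ⟩
      - y + (- 1# + 1#)    ≈⟨ +-congˡ (-‿inverseˡ 1#) ⟩
      - y + 0#             ≈⟨ +-identityʳ (- y) ⟩
      - y                  ∎
      where open SetoidReasoning setoid

    ·-homo-+ : ∀ m n → (m ℕ.+ n) · 1# ≈ m · 1# + n · 1#
    ·-homo-+ zero    n = sym (+-identityˡ _)
    ·-homo-+ (suc m) n =
      trans (+-congˡ (·-homo-+ m n)) (sym (+-assoc 1# (m · 1#) (n · 1#)))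

    fromℤ-neg : ∀ n → fromℤ (ℤ.- (+ n)) ≈ - (n · 1#)
    fromℤ-neg zero    = sym -0#≈0#
    fromℤ-neg (suc n) = refl

    -<⇒-< : ∀ {x y} → - x < y → - y < x
    -<⇒-< {x} {y} -x<y = <-respˡ-≈ left (<-respʳ-≈ right (+-monoˡ-< (x + - y) -x<y))
      where
      open SetoidReasoning setoid
      left : - x + (x + - y) ≈ - y
      left = begin
        - x + (x + - y)  ≈⟨ +-assoc (- x) x (- y) ⟨
        (- x + x) + - y  ≈⟨ +-congʳ (-‿inverseˡ x) ⟩
        0# + - y         ≈⟨ +-identityˡ (- y) ⟩
        - y              ∎
      right : y + (x + - y) ≈ x
      right = begin
        y + (x + - y)    ≈⟨ +-congˡ (+-comm x (- y)) ⟩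
        y + (- y + x)    ≈⟨ +-assoc y (- y) x ⟨
        (y + - y) + x    ≈⟨ +-congʳ (-‿inverseʳ y) ⟩
        0# + x           ≈⟨ +-identityˡ x ⟩
        x                ∎

  fromℤ-suc : ∀ z → fromℤ (ℤ.suc z) ≈ fromℤ z + 1#
  fromℤ-suc (+ n)          = +-comm 1# (n · 1#)
  fromℤ-suc -[1+ zero ]    = sym (trans (-‿suc 0#) -0#≈0#)
  fromℤ-suc -[1+ suc n ]   = sym (-‿suc (suc n · 1#))

  <-≤-trans : ∀ {x y z} → x < y → y ≤ z → x < z
  <-≤-trans x<y (inj₁ y<z) = <-trans x<y y<z
  <-≤-trans x<y (inj₂ y≈z) = <-respʳ-≈ y≈z x<y

  ≤-<-trans : ∀ {x y z} → x ≤ y → y < z → x < z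
  ≤-<-trans (inj₁ x<y) y<z = <-trans x<y y<z
  ≤-<-trans (inj₂ x≈y) y<z = <-respˡ-≈ (sym x≈y) y<z

  private
    search : ∀ k z x → fromℤ z ≤ x → x < fromℤ z + k · 1# →
             ∃ λ n → fromℤ n ≤ x × x < fromℤ n + 1#
    search zero    z x z≤x x<z =
      contradiction (<-≤-trans (<-respʳ-≈ (+-identityʳ _) x<z) z≤x) (<-irrefl refl)
    search (suc k) z x z≤x x<z+1+k with compare x (fromℤ z + 1#)
    ... | tri< x<z+1 _ _ = z , z≤x , x<z+1
    ... | tri≈ _ x≈z+1 _ =
      search k (ℤ.suc z) x (inj₂ (trans (fromℤ-suc z) (sym x≈z+1))) (<-respʳ-≈ shift x<z+1+k)
      where
      shift : fromℤ z + (1# + k · 1#) ≈ fromℤ (ℤ.suc z) + k · 1#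
      shift = trans (sym (+-assoc _ _ _)) (+-congʳ (sym (fromℤ-suc z)))
    ... | tri> _ _ z+1<x =
      search k (ℤ.suc z) x (inj₁ (<-respˡ-≈ (sym (fromℤ-suc z)) z+1<x)) (<-respʳ-≈ shift x<z+1+k)
      where
      shift : fromℤ z + (1# + k · 1#) ≈ fromℤ (ℤ.suc z) + k · 1#
      shift = trans (sym (+-assoc _ _ _)) (+-congʳ (sym (fromℤ-suc z)))

  integralPart : ∀ x → ∃ λ n → fromℤ n ≤ x × x < fromℤ n + 1#
  integralPart x with archimedean (- x) | archimedean x
  ... | N , -x<N | M , x<M =
    search (N ℕ.+ M) (ℤ.- (+ N)) x
      (inj₁ (<-respˡ-≈ (sym (fromℤ-neg N)) (-<⇒-< -x<N)))
      (<-respʳ-≈ (sym cancel) x<M)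
    where
    open SetoidReasoning setoid
    cancel : fromℤ (ℤ.- (+ N)) + (N ℕ.+ M) · 1# ≈ M · 1#
    cancel = begin
      fromℤ (ℤ.- (+ N)) + (N ℕ.+ M) · 1#    ≈⟨ +-cong (fromℤ-neg N) (·-homo-+ N M) ⟩
      - (N · 1#) + (N · 1# + M · 1#)        ≈⟨ +-assoc _ _ _ ⟨
      (- (N · 1#) + N · 1#) + M · 1#        ≈⟨ +-congʳ (-‿inverseˡ _) ⟩
      0# + M · 1#                           ≈⟨ +-identityˡ _ ⟩
      M · 1#                                ∎

  ⌊_⌋ : Carrier → ℤ
  ⌊ x ⌋ = proj₁ (integralPart x)

  ⌊⌋-lower : ∀ x → fromℤ ⌊ x ⌋ ≤ x
  ⌊⌋-lower x = proj₁ (proj₂ (integralPart x))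

  ⌊⌋-upper : ∀ x → x < fromℤ ⌊ x ⌋ + 1#
  ⌊⌋-upper x = proj₂ (proj₂ (integralPart x))

  ----------------------------------------------------------------------
  -- Sums over the integers n with a < n ≤ b

  infix 4 _∈⟨_,_]
  _∈⟨_,_] : ℤ → Carrier → Carrier → Set (ℓ₁ ⊔ ℓ₂)
  n ∈⟨ a , b ] = a < fromℤ n × fromℤ n ≤ b

  _∈⟨_,_]? : ∀ n a b → Dec (n ∈⟨ a , b ])
  n ∈⟨ a , b ]? = (a <? fromℤ n) ×-dec (fromℤ n ≤? b)

  -- A finite list of consecutive integers containing all n with a < n ≤ b.
  candidates : Carrier → Carrier → List ℤ
  candidates a b = applyUpTo (λ k → ⌊ a ⌋ ℤ.+ + k) (suc ℤ.∣ ⌊ b ⌋ ℤ.- ⌊ a ⌋ ∣)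

  integersIn : Carrier → Carrier → List ℤ
  integersIn a b = filter (_∈⟨ a , b ]?) (candidates a b)

  sumOverIntegers : Carrier → Carrier → (Carrier → Carrier) → Carrier
  sumOverIntegers a b f = foldr _+_ 0# (map (λ n → f (fromℤ n)) (integersIn a b))

  syntax sumOverIntegers a b (λ n → e) = ∑[ a < n ≤ b ] e

  integersIn-unique : ∀ a b → Unique (integersIn a b)
  integersIn-unique a b = Unique.filter⁺ (_∈⟨ a , b ]?)
    (Unique.applyUpTo⁺₁ (λ k → ⌊ a ⌋ ℤ.+ + k) _ λ {i} {j} i<j _ eq →
      ℕ.<⇒≢ i<j (ℤ.+-injective (RingProperties.+-cancelˡ ℤ.+-*-ring ⌊ a ⌋ (+ i) (+ j) eq)))

  0<1 : 0# < 1#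
  0<1 with compare 0# 1#
  ... | tri< p _ _ = p
  ... | tri≈ _ p _ = contradiction p 0≉1
  ... | tri> _ _ p = contradiction (<-respʳ-≈ square (*-pos 0<-1 0<-1)) (<-asym p)
    where
    open RingProperties ring using (-‿distribˡ-*; -‿distribʳ-*)
    0<-1 : 0# < - 1#
    0<-1 = <-respʳ-≈ (+-identityˡ _) (<-respˡ-≈ (-‿inverseʳ 1#) (+-monoˡ-< (- 1#) p))
    square : - 1# * - 1# ≈ 1#
    square = trans (sym (-‿distribˡ-* 1# (- 1#)))
               (trans (-‿cong (*-identityˡ (- 1#))) (-‿involutive 1#))

  private
    fromℤ-step : ∀ z → fromℤ z < fromℤ (ℤ.suc z)
    fromℤ-step z = <-respʳ-≈ (trans (+-comm _ _) (sym (fromℤ-suc z)))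
      (<-respˡ-≈ (+-identityˡ _) (+-monoˡ-< (fromℤ z) 0<1))

    fromℤ-≤-shift : ∀ z k → fromℤ z ≤ fromℤ (z ℤ.+ + k)
    fromℤ-≤-shift z zero    = inj₂ (reflexive (≡.cong fromℤ (≡.sym (ℤ.+-identityʳ z))))
    fromℤ-≤-shift z (suc k) = inj₁ (≤-<-trans (fromℤ-≤-shift z k)
      (<-respʳ-≈ (reflexive (≡.cong fromℤ shift)) (fromℤ-step (z ℤ.+ + k))))
      where
      shift : ℤ.suc (z ℤ.+ + k) ≡ z ℤ.+ + suc k
      shift = ≡.trans (≡.sym (ℤ.+-assoc (+ 1) z (+ k)))
        (≡.trans (≡.cong (ℤ._+ + k) (ℤ.+-comm (+ 1) z)) (ℤ.+-assoc z (+ 1) (+ k)))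

  ≤⇒+ℕ : ∀ {z w} → z ℤ.≤ w → z ℤ.+ + ℤ.∣ w ℤ.- z ∣ ≡ w
  ≤⇒+ℕ {z} {w} z≤w = ≡.trans (≡.cong (λ i → z ℤ.+ i) (ℤ.0≤i⇒+∣i∣≡i (ℤ.i≤j⇒0≤j-i z≤w)))
    (≡.trans (ℤ.+-comm z (w ℤ.- z)) (≡.trans (ℤ.+-assoc w (ℤ.- z) z)
      (≡.trans (≡.cong (λ i → w ℤ.+ i) (ℤ.+-inverseˡ z)) (ℤ.+-identityʳ w))))

  fromℤ-mono-≤ : ∀ {z w} → z ℤ.≤ w → fromℤ z ≤ fromℤ w
  fromℤ-mono-≤ {z} z≤w = ≡.subst (λ i → fromℤ z ≤ fromℤ i) (≤⇒+ℕ z≤w) (fromℤ-≤-shift z _)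

  fromℤ-cancel-< : ∀ {z w} → fromℤ z < fromℤ w → z ℤ.< w
  fromℤ-cancel-< {z} {w} z<w with z ℤ.<? w
  ... | yes p = p
  ... | no ¬p = contradiction (<-≤-trans z<w (fromℤ-mono-≤ (ℤ.≮⇒≥ ¬p))) (<-irrefl refl)

  ≤⇒≤⌊⌋ : ∀ {n x} → fromℤ n ≤ x → n ℤ.≤ ⌊ x ⌋
  ≤⇒≤⌊⌋ {n} {x} n≤x = ≡.subst (n ℤ.≤_) (ℤ.pred-suc ⌊ x ⌋) (ℤ.i<j⇒i≤pred[j]
    {i = n} {j = ℤ.suc ⌊ x ⌋}
    (fromℤ-cancel-< (<-respʳ-≈ (sym (fromℤ-suc ⌊ x ⌋)) (≤-<-trans n≤x (⌊⌋-upper x)))))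

  ∈-integersIn : ∀ a b n → n ∈ integersIn a b ⇔ n ∈⟨ a , b ]
  ∈-integersIn a b n = mk⇔ (λ p → proj₂ (∈-filter⁻ (_∈⟨ a , b ]?) p)) complete-list
    where
    complete-list : n ∈⟨ a , b ] → n ∈ integersIn a b
    complete-list n∈@(a<n , n≤b) = ∈-filter⁺ (_∈⟨ a , b ]?)
      (≡.subst (_∈ candidates a b) (≤⇒+ℕ ⌊a⌋≤n)
        (∈-applyUpTo⁺ (λ k → ⌊ a ⌋ ℤ.+ + k) (s≤s (ℤ.drop‿+≤+ bound)))) n∈
      where
      ⌊a⌋≤n : ⌊ a ⌋ ℤ.≤ n
      ⌊a⌋≤n = ℤ.<⇒≤ (fromℤ-cancel-< (≤-<-trans (⌊⌋-lower a) a<n))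
      n≤⌊b⌋ : n ℤ.≤ ⌊ b ⌋
      n≤⌊b⌋ = ≤⇒≤⌊⌋ n≤b
      bound : + ℤ.∣ n ℤ.- ⌊ a ⌋ ∣ ℤ.≤ + ℤ.∣ ⌊ b ⌋ ℤ.- ⌊ a ⌋ ∣
      bound = ≡.subst₂ ℤ._≤_
        (≡.sym (ℤ.0≤i⇒+∣i∣≡i (ℤ.i≤j⇒0≤j-i ⌊a⌋≤n)))
        (≡.sym (ℤ.0≤i⇒+∣i∣≡i (ℤ.i≤j⇒0≤j-i (ℤ.≤-trans ⌊a⌋≤n n≤⌊b⌋))))
        (ℤ.+-monoˡ-≤ (ℤ.- ⌊ a ⌋) n≤⌊b⌋)

  ----------------------------------------------------------------------
  -- Continuity from the left

  LeftContinuousAt : (Carrier → Carrier) → Carrier → Set (c ⊔ ℓ₂)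
  LeftContinuousAt f p = ∀ ε → 0# < ε →
    ∃ λ δ → 0# < δ × (∀ x → p - δ < x → x < p → ∣ f x - f p ∣ < ε)

  ----------------------------------------------------------------------
  -- Riemann–Stieltjes integral

  infixr 5 _∷_

  data Partition : Carrier → Carrier → Set (c ⊔ ℓ₁ ⊔ ℓ₂) where
    [_] : ∀ {x y} → x ≈ y → Partition x y
    _∷_ : ∀ {x y z} → x ≤ y → Partition y z → Partition x z

  points : ∀ {x y} → Partition x y → List Carrier
  points ([_] {x} _)   = x ∷ []
  points (_∷_ {x} _ P) = x ∷ points P

  infix 4 _Refines_
  _Refines_ : ∀ {x y} → Partition x y → Partition x y → Set (c ⊔ ℓ₁)
  Q Refines P = points P ⊆ points Q
    where open Subset setoid using (_⊆_)

  data Tags : ∀ {x y} → Partition x y → Set (c ⊔ ℓ₁ ⊔ ℓ₂) where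
    []  : ∀ {x y} {x≈y : x ≈ y} → Tags [ x≈y ]
    tag : ∀ {x y z} {x≤y : x ≤ y} {P : Partition y z} →
          ∀ t → x ≤ t → t ≤ y → Tags P → Tags (x≤y ∷ P)

  stieltjesSum : (φ α : Carrier → Carrier) →
                 ∀ {x y} {P : Partition x y} → Tags P → Carrier
  stieltjesSum φ α []                    = 0#
  stieltjesSum φ α (tag {x} {y} t _ _ τ) = φ t * (α y - α x) + stieltjesSum φ α τ

  -- The limit is taken over partitions directed by refinement, not as the
  -- mesh tends to 0.  With the latter the integral of u - [u] - ½ against
  -- df may fail to exist when f jumps on the right of an integer; for
  -- α u = u the two notions agree.
  IsIntegral : (φ α : Carrier → Carrier) (a b : Carrier) → Carrier → Set (c ⊔ ℓ₁ ⊔ ℓ₂)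
  IsIntegral φ α a b I = ∀ ε → 0# < ε →
    ∃ λ (P : Partition a b) → ∀ (Q : Partition a b) → Q Refines P →
      ∀ (τ : Tags Q) → ∣ stieltjesSum φ α τ - I ∣ < ε

  RiemannStieltjesIntegrable : (φ α : Carrier → Carrier) (a b : Carrier) → Set (c ⊔ ℓ₁ ⊔ ℓ₂)
  RiemannStieltjesIntegrable φ α a b = ∃ (IsIntegral φ α a b)

  RiemannIntegrable : (f : Carrier → Carrier) (a b : Carrier) → Set (c ⊔ ℓ₁ ⊔ ℓ₂)
  RiemannIntegrable f = RiemannStieltjesIntegrable f (λ u → u)

  ∫ : ∀ {φ α a b} → RiemannStieltjesIntegrable φ α a b → Carrier
  ∫ = proj₁

-- Splitting each subinterval at its tag turns a Stieltjes sum for ∫ g df into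
-- f(b)g(b) − f(a)g(a) minus a Stieltjes sum for ∫ f dg over a refinement, so
-- the former integral exists as soon as the latter does.  For g u = u − [u] − ½
-- the integral ∫ f dg is ∫ f du − ∫ f d[u].  On [a, b] the integral part is, up
-- to a constant, the sum over a < n ≤ b of the unit jumps at n; as these are
-- right-continuous, a fine partition only samples f just to the left of n, and
-- left continuity gives ∫ f d[u] = ∑ f(n).

module Submission where

open import Data.Integer.Base using (ℤ)
open import Data.Product.Base using (Σ-syntax)
open import Relation.Binary.Core using (_Preserves_⟶_)
open import Defs

open import Algebra.Solver.Ring.AlmostCommutativeRing
  using (fromCommutativeRing; _-Raw-AlmostCommutative⟶_)
open import Data.Integer.Base as ℤ using (+_; -[1+_])
import Data.Integer.Properties as ℤ
open import Data.List.Base using (List; []; _∷_; map; foldr; filter; applyUpTo)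
open import Data.List.Membership.Setoid.Properties using (∈-resp-≈)
open import Data.List.Properties using (filter-reject; map-applyUpTo)
open import Data.List.Relation.Unary.All as All using (All; []; _∷_)
import Data.List.Relation.Unary.All.Properties as All
open import Data.List.Relation.Unary.Any using (here; there)
open import Data.Maybe.Base using (Maybe; just; nothing)
open import Data.Nat.Base as ℕ using (ℕ; zero; suc; s≤s)
import Data.Nat.Properties as ℕ
open import Data.Product.Base using (∃; _×_; _,_; proj₁; proj₂)
open import Data.Sum.Base using (_⊎_; inj₁; inj₂)
open import Function.Bundles using (Equivalence)
open import Relation.Binary.Bundles using (DecTotalOrder)
open import Relation.Binary.Definitions using (tri<; tri≈; tri>)
open import Relation.Binary.PropositionalEquality as ≡ using (_≡_)
open import Relation.Nullary using (¬_; yes; no; contradiction)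
open import Relation.Unary using (Decidable)

import Algebra.Properties.Monoid.Mult as MonoidMult
import Algebra.Properties.Ring as RingProperties
import Algebra.Solver.Ring as RingSolver
import Data.List.Membership.Setoid as Membership
import Data.List.Relation.Binary.Subset.Setoid as Subset
import Relation.Binary.Properties.StrictTotalOrder as StrictTotalOrderProperties
import Relation.Binary.Reasoning.Setoid as SetoidReasoning

module EulerSummation {c ℓ₁ ℓ₂} (R : RealField c ℓ₁ ℓ₂) where

  open RealField R
  open RealAnalysis R
  open RingProperties ring
    using (-‿involutive; -‿+-comm; -0#≈0#; -‿distribˡ-*)
  open DecTotalOrder (StrictTotalOrderProperties.decTotalOrder strictTotalOrder)
    using () renaming (trans to ≤-trans; refl to ≤-refl; total to ≤-total)
  open Subset setoid using (_⊆_)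
  open Membership setoid using () renaming (_∈_ to _∈ˢ_)

  -- The integers act as coefficients of the ring solver

  fromℤ-⊖ : ∀ m n → fromℤ (m ℤ.⊖ n) ≈ m · 1# - n · 1#
  fromℤ-⊖ m       zero    = sym (trans (+-congˡ -0#≈0#) (+-identityʳ _))
  fromℤ-⊖ zero    (suc n) = sym (+-identityˡ _)
  fromℤ-⊖ (suc m) (suc n) = begin
    fromℤ (suc m ℤ.⊖ suc n)             ≡⟨ ≡.cong fromℤ (ℤ.[1+m]⊖[1+n]≡m⊖n m n) ⟩
    fromℤ (m ℤ.⊖ n)                     ≈⟨ fromℤ-⊖ m n ⟩
    -- This computation is among the data from which the solver is built, so `1# - 1#` is inserted
    -- and regrouped by hand.
    m · 1# - n · 1#                     ≈⟨ +-identityˡ _ ⟨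
    0# + (m · 1# - n · 1#)              ≈⟨ +-congʳ (-‿inverseʳ 1#) ⟨
    (1# - 1#) + (m · 1# - n · 1#)       ≈⟨ +-assoc _ _ _ ⟩
    1# + (- 1# + (m · 1# - n · 1#))     ≈⟨ +-congˡ (+-assoc _ _ _) ⟨
    1# + ((- 1# + m · 1#) - n · 1#)     ≈⟨ +-congˡ (+-congʳ (+-comm _ _)) ⟩
    1# + ((m · 1# - 1#) - n · 1#)       ≈⟨ +-congˡ (+-assoc _ _ _) ⟩
    1# + (m · 1# + (- 1# - n · 1#))     ≈⟨ +-assoc _ _ _ ⟨
    suc m · 1# + (- 1# - n · 1#)        ≈⟨ +-congˡ (-‿+-comm _ _) ⟩
    suc m · 1# - suc n · 1#             ∎
    where open SetoidReasoning setoid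

  fromℤ-+ : ∀ i j → fromℤ (i ℤ.+ j) ≈ fromℤ i + fromℤ j
  fromℤ-+ (+ m)    (+ n)    = MonoidMult.×-homo-+ +-monoid 1# m n
  fromℤ-+ (+ m)    -[1+ n ] = fromℤ-⊖ m (suc n)
  fromℤ-+ -[1+ m ] (+ n)    = trans (fromℤ-⊖ n (suc m)) (+-comm _ _)
  fromℤ-+ -[1+ m ] -[1+ n ] = begin
    - (suc (suc (m ℕ.+ n)) · 1#)       ≡⟨ ≡.cong (λ k → - (suc k · 1#)) (ℕ.+-suc m n) ⟨
    - ((suc m ℕ.+ suc n) · 1#)         ≈⟨ -‿cong (MonoidMult.×-homo-+ +-monoid 1# (suc m) (suc n)) ⟩
    - (suc m · 1# + suc n · 1#)        ≈⟨ -‿+-comm _ _ ⟨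
    - (suc m · 1#) - suc n · 1#        ∎
    where open SetoidReasoning setoid

  fromℤ-neg : ∀ i → fromℤ (ℤ.- i) ≈ - fromℤ i
  fromℤ-neg (+ zero)  = sym -0#≈0#
  fromℤ-neg (+ suc n) = refl
  fromℤ-neg -[1+ n ]  = sym (-‿involutive _)

  fromℤ-*-ℕ : ∀ m j → fromℤ (+ m ℤ.* j) ≈ fromℤ (+ m) * fromℤ j
  fromℤ-*-ℕ zero    j = sym (zeroˡ _)
  fromℤ-*-ℕ (suc m) j = begin
    fromℤ (+ suc m ℤ.* j)              ≡⟨ ≡.cong fromℤ (ℤ.suc-* (+ m) j) ⟩
    fromℤ (j ℤ.+ + m ℤ.* j)            ≈⟨ fromℤ-+ j (+ m ℤ.* j) ⟩
    fromℤ j + fromℤ (+ m ℤ.* j)        ≈⟨ +-cong (sym (*-identityˡ _)) (fromℤ-*-ℕ m j) ⟩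
    1# * fromℤ j + m · 1# * fromℤ j    ≈⟨ distribʳ _ _ _ ⟨
    fromℤ (+ suc m) * fromℤ j          ∎
    where open SetoidReasoning setoid

  fromℤ-* : ∀ i j → fromℤ (i ℤ.* j) ≈ fromℤ i * fromℤ j
  fromℤ-* (+ m)    j = fromℤ-*-ℕ m j
  fromℤ-* -[1+ m ] j = begin
    fromℤ (-[1+ m ] ℤ.* j)             ≡⟨ ≡.cong fromℤ (ℤ.neg-distribˡ-* (+ suc m) j) ⟨
    fromℤ (ℤ.- (+ suc m ℤ.* j))        ≈⟨ fromℤ-neg (+ suc m ℤ.* j) ⟩
    - fromℤ (+ suc m ℤ.* j)            ≈⟨ -‿cong (fromℤ-*-ℕ (suc m) j) ⟩
    - (fromℤ (+ suc m) * fromℤ j)      ≈⟨ -‿distribˡ-* _ _ ⟩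
    fromℤ -[1+ m ] * fromℤ j           ∎
    where open SetoidReasoning setoid

  fromℤ-morphism : ℤ.+-*-rawRing -Raw-AlmostCommutative⟶ fromCommutativeRing commutativeRing
  fromℤ-morphism = record
    { ⟦_⟧    = fromℤ
    ; +-homo = fromℤ-+
    ; *-homo = fromℤ-*
    ; -‿homo = fromℤ-neg
    ; 0-homo = refl
    ; 1-homo = +-identityʳ 1#
    }

  fromℤ-≟ : ∀ i j → Maybe (fromℤ i ≈ fromℤ j)
  fromℤ-≟ i j with i ℤ.≟ j
  ... | yes ≡.refl = just refl
  ... | no _       = nothing

  open RingSolver ℤ.+-*-rawRing (fromCommutativeRing commutativeRing) fromℤ-morphism fromℤ-≟
    public using (solve; _:=_; _:+_; _:*_; _:-_; :-_)

  -- Order and absolute value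

  <⇒≱ : ∀ {x y} → x < y → ¬ y ≤ x
  <⇒≱ x<y y≤x = <-irrefl refl (<-≤-trans x<y y≤x)

  ≮⇒≥ : ∀ {x y} → ¬ x < y → y ≤ x
  ≮⇒≥ {x} {y} x≮y with compare x y
  ... | tri< x<y _ _ = contradiction x<y x≮y
  ... | tri≈ _ x≈y _ = inj₂ (sym x≈y)
  ... | tri> _ _ y<x = inj₁ y<x

  +-mono-< : ∀ {x y u v} → x < y → u < v → x + u < y + v
  +-mono-< {x} {y} {u} {v} x<y u<v = <-trans (+-monoˡ-< u x<y)
    (<-respˡ-≈ (+-comm u y) (<-respʳ-≈ (+-comm v y) (+-monoˡ-< y u<v)))

  x-y<x : ∀ {x y} → 0# < y → x - y < x
  x-y<x {x} {y} 0<y = <-respˡ-≈ (+-identityˡ _)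
    (<-respʳ-≈ (solve 2 (λ x y → y :+ (x :- y) := x) refl x y) (+-monoˡ-< (x - y) 0<y))

  1+1≉0 : 1# + 1# ≉ 0#
  1+1≉0 eq = <-irrefl (sym eq) (<-respˡ-≈ (+-identityˡ 0#) (+-mono-< 0<1 0<1))

  ½+½≈1 : ½ + ½ ≈ 1#
  ½+½≈1 = begin
    ½ + ½               ≈⟨ +-cong (*-identityˡ ½) (*-identityˡ ½) ⟨
    1# * ½ + 1# * ½     ≈⟨ distribʳ ½ 1# 1# ⟨
    (1# + 1#) * ½       ≈⟨ ⁻¹-inverseʳ 1+1≉0 ⟩
    1#                  ∎
    where open SetoidReasoning setoid

  -- The sign is read off from `½ + ½ ≈ 1#`: a zero or negative `½` would make `1#` zero or
  -- negative.
  0<½ : 0# < ½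
  0<½ with compare 0# ½
  ... | tri< 0<½ _ _ = 0<½
  ... | tri≈ _ 0≈½ _ = contradiction
    (trans (sym (+-identityˡ 0#)) (trans (+-cong 0≈½ 0≈½) ½+½≈1)) 0≉1
  ... | tri> _ _ ½<0 = contradiction
    (<-respˡ-≈ ½+½≈1 (<-respʳ-≈ (+-identityˡ 0#) (+-mono-< ½<0 ½<0))) (<-asym 0<1)

  x½+x½≈x : ∀ x → x * ½ + x * ½ ≈ x
  x½+x½≈x x = trans (sym (distribˡ x ½ ½)) (trans (*-congˡ ½+½≈1) (*-identityʳ x))

  -‿0< : ∀ {x} → x < 0# → 0# < - x
  -‿0< {x} x<0 = <-respˡ-≈ (-‿inverseʳ x) (<-respʳ-≈ (+-identityˡ _) (+-monoˡ-< (- x) x<0))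

  -‿<0 : ∀ {x} → 0# < x → - x < 0#
  -‿<0 {x} 0<x = <-respˡ-≈ (+-identityˡ _) (<-respʳ-≈ (-‿inverseʳ x) (+-monoˡ-< (- x) 0<x))

  -- With its two converses below, this trades a bound on `∣ x ∣` for a pair of one-sided bounds, so
  -- that the later estimates need no case split on the sign.
  ∣x∣<ε : ∀ {x ε} → x < ε → - x < ε → ∣ x ∣ < ε
  ∣x∣<ε {x} x<ε -x<ε with x <? 0#
  ... | yes _ = -x<ε
  ... | no  _ = x<ε

  ∣x∣<ε⇒x<ε : ∀ {x ε} → ∣ x ∣ < ε → x < ε
  ∣x∣<ε⇒x<ε {x} ∣x∣<ε with x <? 0#
  ... | yes x<0 = <-trans x<0 (<-trans (-‿0< x<0) ∣x∣<ε)
  ... | no  _   = ∣x∣<ε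

  ∣x∣<ε⇒-x<ε : ∀ {x ε} → ∣ x ∣ < ε → - x < ε
  ∣x∣<ε⇒-x<ε {x} ∣x∣<ε with x <? 0#
  ... | yes _   = ∣x∣<ε
  ... | no  x≮0 with ≮⇒≥ x≮0
  ...   | inj₁ 0<x = <-trans (-‿<0 0<x) (<-trans 0<x ∣x∣<ε)
  ...   | inj₂ 0≈x = <-respˡ-≈ (trans (sym 0≈x) (trans (sym -0#≈0#) (-‿cong 0≈x))) ∣x∣<ε

  ∣∣<-resp-≈ : ∀ {x y ε} → x ≈ y → ∣ x ∣ < ε → ∣ y ∣ < ε
  ∣∣<-resp-≈ x≈y p =
    ∣x∣<ε (<-respˡ-≈ x≈y (∣x∣<ε⇒x<ε p)) (<-respˡ-≈ (-‿cong x≈y) (∣x∣<ε⇒-x<ε p))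

  ∣∣<-0 : ∀ {x ε} → x ≈ 0# → 0# < ε → ∣ x ∣ < ε
  ∣∣<-0 x≈0 0<ε = ∣x∣<ε (<-respˡ-≈ (sym x≈0) 0<ε)
    (<-respˡ-≈ (trans (sym -0#≈0#) (-‿cong (sym x≈0))) 0<ε)

  ∣∣<-neg : ∀ {x ε} → ∣ x ∣ < ε → ∣ - x ∣ < ε
  ∣∣<-neg p = ∣x∣<ε (∣x∣<ε⇒-x<ε p) (<-respˡ-≈ (sym (-‿involutive _)) (∣x∣<ε⇒x<ε p))

  ∣∣<-+ : ∀ {x y δ ε} → ∣ x ∣ < δ → ∣ y ∣ < ε → ∣ x + y ∣ < δ + ε
  ∣∣<-+ p q = ∣x∣<ε (+-mono-< (∣x∣<ε⇒x<ε p) (∣x∣<ε⇒x<ε q))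
    (<-respˡ-≈ (-‿+-comm _ _) (+-mono-< (∣x∣<ε⇒-x<ε p) (∣x∣<ε⇒-x<ε q)))

  -- Partitions and refinement

  partition⇒≤ : ∀ {x y} → Partition x y → x ≤ y
  partition⇒≤ [ x≈y ]   = inj₂ x≈y
  partition⇒≤ (x≤y ∷ P) = ≤-trans x≤y (partition⇒≤ P)

  points-within : ∀ {x y} (P : Partition x y) → All (λ p → x ≤ p × p ≤ y) (points P)
  points-within [ x≈y ]   = (≤-refl , inj₂ x≈y) ∷ []
  points-within (x≤z ∷ P) = (≤-refl , ≤-trans x≤z (partition⇒≤ P)) ∷
    All.map (λ (z≤p , p≤y) → ≤-trans x≤z z≤p , p≤y) (points-within P)

  start≤point : ∀ {x y p} (P : Partition x y) → p ∈ˢ points P → x ≤ p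
  start≤point [ x≈y ]   (here p≈x)  = inj₂ (sym p≈x)
  start≤point (x≤z ∷ P) (here p≈x)  = inj₂ (sym p≈x)
  start≤point (x≤z ∷ P) (there p∈P) = ≤-trans x≤z (start≤point P p∈P)

  -- The walk passes the cells that end before `c` and splits the first one that does not. Iterating
  -- over the points of another partition yields common refinements, which allow two integrals to be
  -- estimated on one partition.
  insertPoint : ∀ {x y} c → x ≤ c → c ≤ y → (P : Partition x y) →
                ∃ λ (Q : Partition x y) → Q Refines P × c ∈ˢ points Q
  insertPoint c x≤c c≤y [ x≈y ] =
    x≤c ∷ c≤y ∷ [ refl ] , (λ { (here p) → here p }) , there (here refl)
  insertPoint c x≤c c≤y (_∷_ {y = z} x≤z P) with ≤-total c z
  ... | inj₁ c≤z = x≤c ∷ c≤z ∷ P , (λ { (here p) → here p ; (there p) → there (there p) }) ,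
    there (here refl)
  ... | inj₂ z≤c with insertPoint c z≤c c≤y P
  ...   | Q , P⊆Q , c∈Q = x≤z ∷ Q , (λ { (here p) → here p ; (there p) → there (P⊆Q p) }) ,
    there c∈Q

  insertPoints : ∀ {x y} {cs} → All (λ c → x ≤ c × c ≤ y) cs → (P : Partition x y) →
                 ∃ λ (Q : Partition x y) → Q Refines P × cs ⊆ points Q
  insertPoints [] P = P , (λ p → p) , λ ()
  insertPoints ((x≤c , c≤y) ∷ cs) P with insertPoints cs P
  ... | Q , P⊆Q , cs⊆Q with insertPoint _ x≤c c≤y Q
  ...   | S , Q⊆S , c∈S = S , (λ p → Q⊆S (P⊆Q p)) ,
    λ { (here p≈c) → ∈-resp-≈ setoid (sym p≈c) c∈S ; (there p) → Q⊆S (cs⊆Q p) }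

  commonRefinement : ∀ {x y} (P Q : Partition x y) →
                     ∃ λ (S : Partition x y) → S Refines P × S Refines Q
  commonRefinement P Q with insertPoints (points-within Q) P
  ... | S , P⊆S , Q⊆S = S , P⊆S , Q⊆S

  -- Linearity of the integral in the integrator

  stieltjesSum-+ : ∀ φ α β {x y} {P : Partition x y} (τ : Tags P) →
                   stieltjesSum φ (λ u → α u + β u) τ ≈ stieltjesSum φ α τ + stieltjesSum φ β τ
  stieltjesSum-+ φ α β [] = sym (+-identityˡ 0#)
  stieltjesSum-+ φ α β (tag {x} {y} t _ _ τ) = trans (+-congˡ (stieltjesSum-+ φ α β τ))
    (solve 7 (λ p a b c d s r → p :* ((a :+ b) :- (c :+ d)) :+ (s :+ r)
                := (p :* (a :- c) :+ s) :+ (p :* (b :- d) :+ r))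
      refl (φ t) (α y) (β y) (α x) (β x) (stieltjesSum φ α τ) (stieltjesSum φ β τ))

  stieltjesSum-neg : ∀ φ α {x y} {P : Partition x y} (τ : Tags P) →
                     stieltjesSum φ (λ u → - α u) τ ≈ - stieltjesSum φ α τ
  stieltjesSum-neg φ α [] = sym -0#≈0#
  stieltjesSum-neg φ α (tag {x} {y} t _ _ τ) = trans (+-congˡ (stieltjesSum-neg φ α τ))
    (solve 4 (λ p a c s → p :* ((:- a) :- (:- c)) :+ (:- s) := :- (p :* (a :- c) :+ s))
      refl (φ t) (α y) (α x) (stieltjesSum φ α τ))

  -- A Stieltjes sum sees its integrator only through increments. Agreement up to a constant on
  -- `[a, b]` is therefore enough, which is how the integral part is later replaced by a sum of
  -- jumps.
  SameIncrements : (α β : Carrier → Carrier) (a b : Carrier) → Set _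
  SameIncrements α β a b = ∀ {x y} → a ≤ x → x ≤ y → y ≤ b → α y - α x ≈ β y - β x

  stieltjesSum-cong : ∀ φ {α β a b} → SameIncrements α β a b →
                      ∀ {x y} {P : Partition x y} → a ≤ x → y ≤ b → (τ : Tags P) →
                      stieltjesSum φ α τ ≈ stieltjesSum φ β τ
  stieltjesSum-cong φ α~β a≤x y≤b [] = refl
  stieltjesSum-cong φ α~β a≤x y≤b (tag {x≤y = x≤z} {P = P} t _ _ τ) =
    +-cong (*-congˡ (α~β a≤x x≤z (≤-trans (partition⇒≤ P) y≤b)))
      (stieltjesSum-cong φ α~β (≤-trans a≤x x≤z) y≤b τ)

  IsIntegral-resp : ∀ {φ α β a b I J} → SameIncrements α β a b → I ≈ J →
                    IsIntegral φ α a b I → IsIntegral φ β a b J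
  IsIntegral-resp {φ} α~β I≈J ∫α ε 0<ε with ∫α ε 0<ε
  ... | P , close = P , λ Q Q⊇P τ → ∣∣<-resp-≈
    (+-cong (stieltjesSum-cong φ α~β ≤-refl ≤-refl τ) (-‿cong I≈J)) (close Q Q⊇P τ)

  IsIntegral-+ : ∀ {φ α β a b I J} → IsIntegral φ α a b I → IsIntegral φ β a b J →
                 IsIntegral φ (λ u → α u + β u) a b (I + J)
  IsIntegral-+ {φ} {α} {β} {I = I} {J} ∫α ∫β ε 0<ε
    with ∫α (ε * ½) (*-pos 0<ε 0<½) | ∫β (ε * ½) (*-pos 0<ε 0<½)
  ... | P₁ , close₁ | P₂ , close₂ with commonRefinement P₁ P₂
  ...   | P , P⊇P₁ , P⊇P₂ = P , λ Q Q⊇P τ → ∣∣<-resp-≈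
    (trans
      (solve 4 (λ s i r j → (s :- i) :+ (r :- j) := (s :+ r) :- (i :+ j)) refl
        (stieltjesSum φ α τ) I (stieltjesSum φ β τ) J)
      (+-congʳ (sym (stieltjesSum-+ φ α β τ))))
    (<-respʳ-≈ (x½+x½≈x ε)
      (∣∣<-+ (close₁ Q (λ p → Q⊇P (P⊇P₁ p)) τ) (close₂ Q (λ p → Q⊇P (P⊇P₂ p)) τ)))

  IsIntegral-neg : ∀ {φ α a b I} → IsIntegral φ α a b I →
                   IsIntegral φ (λ u → - α u) a b (- I)
  IsIntegral-neg {φ} {α} {I = I} ∫α ε 0<ε with ∫α ε 0<ε
  ... | P , close = P , λ Q Q⊇P τ → ∣∣<-resp-≈
    (trans (sym (-‿+-comm _ _)) (+-congʳ (sym (stieltjesSum-neg φ α τ))))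
    (∣∣<-neg (close Q Q⊇P τ))

  IsIntegral-const : ∀ {φ a b} k → a ≤ b → IsIntegral φ (λ _ → k) a b 0#
  -- Every sum vanishes, so any partition would do; the one-cell partition is the simplest.
  IsIntegral-const {φ} k a≤b ε 0<ε = a≤b ∷ [ refl ] , λ Q _ τ →
    ∣∣<-0 (trans (+-congʳ (sum≈0 τ)) (-‿inverseʳ 0#)) 0<ε
    where
    sum≈0 : ∀ {x y} {P : Partition x y} (τ : Tags P) → stieltjesSum φ (λ _ → k) τ ≈ 0#
    sum≈0 [] = refl
    sum≈0 (tag t _ _ τ) = trans (+-cong (trans (*-congˡ (-‿inverseʳ k)) (zeroʳ _)) (sum≈0 τ))
      (+-identityˡ 0#)

  -- Integration by parts

  splitAtTags : ∀ {x y} {P : Partition x y} → Tags P → Partition x y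
  splitAtTags {P = [ x≈y ]} [] = [ x≈y ]
  splitAtTags (tag t x≤t t≤z τ) = x≤t ∷ t≤z ∷ splitAtTags τ

  splitAtTags-refines : ∀ {x y} {P : Partition x y} (τ : Tags P) → splitAtTags τ Refines P
  splitAtTags-refines []              p         = p
  splitAtTags-refines (tag _ _ _ τ) (here p)  = here p
  splitAtTags-refines (tag _ _ _ τ) (there p) = there (there (splitAtTags-refines τ p))

  -- Each half of a split cell is tagged at its outer end, so `f` is sampled exactly at the original
  -- division points, where the sum for `∫ g df` takes its increments.
  endpointTags : ∀ {x y} {P : Partition x y} (τ : Tags P) → Tags (splitAtTags τ)
  endpointTags {P = [ _ ]} [] = []
  endpointTags (tag {x} {z} t x≤t t≤z τ) =
    tag x ≤-refl x≤t (tag z t≤z ≤-refl (endpointTags τ))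

  -- Abel summation: on each subinterval [x, z] with tag t,
  -- g t (f z - f x) + f x (g t - g x) + f z (g z - g t) = f z g z - f x g x.
  stieltjesSum-parts :
    ∀ {f g} → f Preserves _≈_ ⟶ _≈_ → g Preserves _≈_ ⟶ _≈_ →
    ∀ {x y} {P : Partition x y} (τ : Tags P) →
    stieltjesSum g f τ ≈ (f y * g y - f x * g x) - stieltjesSum f g (endpointTags τ)
  -- The endpoints agree only up to `≈`, so the boundary term vanishes through the congruence of `f`
  -- and `g`.
  stieltjesSum-parts {f} {g} f-cong g-cong {x} {y} {[ x≈y ]} [] = sym (begin
    (f y * g y - f x * g x) - 0#  ≈⟨ +-congʳ (+-congˡ (-‿cong (*-cong (f-cong x≈y) (g-cong x≈y)))) ⟩
    (f y * g y - f y * g y) - 0#  ≈⟨ +-congʳ (-‿inverseʳ _) ⟩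
    0# - 0#                       ≈⟨ -‿inverseʳ 0# ⟩
    0#                            ∎)
    where open SetoidReasoning setoid
  stieltjesSum-parts {f} {g} f-cong g-cong {y = y} (tag {x} {z} t x≤t t≤z τ) =
    trans (+-congˡ (stieltjesSum-parts f-cong g-cong τ))
      (solve 7 (λ fx fz gx gt gz fgy s →
          gt :* (fz :- fx) :+ ((fgy :- fz :* gz) :- s)
          := (fgy :- fx :* gx) :- (fx :* (gt :- gx) :+ (fz :* (gz :- gt) :+ s)))
        refl (f x) (f z) (g x) (g t) (g z) (f y * g y) (stieltjesSum f g (endpointTags τ)))

  -- The partition `P` that controls `∫ f dg` serves unchanged: if `Q` refines `P`, then so does `Q`
  -- split at its tags. By the summation identity the two errors are negatives of each other.
  IsIntegral-parts :
    ∀ {f g} → f Preserves _≈_ ⟶ _≈_ → g Preserves _≈_ ⟶ _≈_ →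
    ∀ {a b J} → IsIntegral f g a b J → IsIntegral g f a b ((f b * g b - f a * g a) - J)
  IsIntegral-parts {f} {g} f-cong g-cong {a} {b} {J} ∫fdg ε 0<ε with ∫fdg ε 0<ε
  ... | P , close = P , λ Q Q⊇P τ → ∣∣<-resp-≈
    (trans
      (solve 3 (λ s j d → :- (s :- j) := (d :- s) :- (d :- j)) refl
        (stieltjesSum f g (endpointTags τ)) J (f b * g b - f a * g a))
      (+-congʳ (sym (stieltjesSum-parts f-cong g-cong τ))))
    (∣∣<-neg (close (splitAtTags τ) (λ p → splitAtTags-refines τ (Q⊇P p)) (endpointTags τ)))

  -- Integration against a unit jump

  -- The value at `p` itself is `1#`, as right-continuity of the integral part demands. The jump
  -- thus belongs to the cell `[x, z]` with `x < p` and `p ≤ z`.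
  step : Carrier → Carrier → Carrier
  step p u with p ≤? u
  ... | yes _ = 1#
  ... | no  _ = 0#

  step≈1 : ∀ {p u} → p ≤ u → step p u ≈ 1#
  step≈1 {p} {u} p≤u with p ≤? u
  ... | yes _   = refl
  ... | no  p≰u = contradiction p≤u p≰u

  step≈0 : ∀ {p u} → u < p → step p u ≈ 0#
  step≈0 {p} {u} u<p with p ≤? u
  ... | yes p≤u = contradiction p≤u (<⇒≱ u<p)
  ... | no  _   = refl

  stieltjesSum-step-≥ : ∀ f {p x y} {P : Partition x y} → p ≤ x → (τ : Tags P) →
                        stieltjesSum f (step p) τ ≈ 0#
  stieltjesSum-step-≥ f p≤x [] = refl
  stieltjesSum-step-≥ f {p} {x} p≤x (tag {y = z} {x≤y = x≤z} t _ _ τ) = begin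
    f t * (step p z - step p x) + stieltjesSum f (step p) τ
      ≈⟨ +-cong (*-congˡ (+-cong (step≈1 p≤z) (-‿cong (step≈1 p≤x)))) (stieltjesSum-step-≥ f p≤z τ) ⟩
    f t * (1# - 1#) + 0#   ≈⟨ +-identityʳ _ ⟩
    f t * (1# - 1#)        ≈⟨ *-congˡ (-‿inverseʳ 1#) ⟩
    f t * 0#               ≈⟨ zeroʳ _ ⟩
    0#                     ∎
    where
    open SetoidReasoning setoid
    p≤z = ≤-trans p≤x x≤z

  -- Only the cell containing the jump contributes, and it contributes `f t`. As `p` and `q` are
  -- division points, that cell ends at `p` and starts no earlier than `q`, so `t` lies between `q`
  -- and `p`. The disjunction on `q` is the induction invariant: the walk may already have passed
  -- `q`.
  stieltjesSum-step :
    ∀ {f p q ε} → q < p → (∀ t → q ≤ t → t ≤ p → ∣ f t - f p ∣ < ε) →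
    ∀ {x y} {P : Partition x y} → x < p → p ≤ y →
    q ≤ x ⊎ q ∈ˢ points P → p ∈ˢ points P →
    (τ : Tags P) → ∣ stieltjesSum f (step p) τ - f p ∣ < ε
  stieltjesSum-step q<p near {P = [ x≈y ]} x<p p≤y _ _ [] =
    contradiction (≤-trans p≤y (inj₂ (sym x≈y))) (<⇒≱ x<p)
  stieltjesSum-step q<p near x<p p≤y q∈P (here p≈x) (tag _ _ _ _) =
    contradiction (inj₂ p≈x) (<⇒≱ x<p)
  stieltjesSum-step {f} {p} {q} q<p near {x} x<p p≤y q∈P (there p∈P)
    (tag {y = z} {x≤y = x≤z} {P = P} t x≤t t≤z τ) with z <? p
  ... | yes z<p = ∣∣<-resp-≈ (+-congʳ (sym sum≈rest))
      (stieltjesSum-step q<p near z<p p≤y (q∈rest q∈P) p∈P τ)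
    where
    open SetoidReasoning setoid
    q∈rest : q ≤ x ⊎ q ∈ˢ (x ∷ points P) → q ≤ z ⊎ q ∈ˢ points P
    q∈rest (inj₁ q≤x)         = inj₁ (≤-trans q≤x x≤z)
    q∈rest (inj₂ (here q≈x))  = inj₁ (≤-trans (inj₂ q≈x) x≤z)
    q∈rest (inj₂ (there q∈P)) = inj₂ q∈P
    sum≈rest : f t * (step p z - step p x) + stieltjesSum f (step p) τ ≈ stieltjesSum f (step p) τ
    sum≈rest = begin
      f t * (step p z - step p x) + stieltjesSum f (step p) τ
        ≈⟨ +-congʳ (*-congˡ (+-cong (step≈0 z<p) (-‿cong (step≈0 x<p)))) ⟩
      f t * (0# - 0#) + stieltjesSum f (step p) τ  ≈⟨ +-congʳ (*-congˡ (-‿inverseʳ 0#)) ⟩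
      f t * 0# + stieltjesSum f (step p) τ         ≈⟨ +-congʳ (zeroʳ _) ⟩
      0# + stieltjesSum f (step p) τ               ≈⟨ +-identityˡ _ ⟩
      stieltjesSum f (step p) τ                    ∎
  -- This is the cell with the jump. Since `p` is still to come among the division points, `z ≤ p`,
  -- and hence `t ≤ p`.
  ... | no z≮p = ∣∣<-resp-≈ (+-congʳ (sym sum≈ft))
      (near t (≤-trans (q≤x q∈P) x≤t) (≤-trans t≤z (start≤point P p∈P)))
    where
    open SetoidReasoning setoid
    p≤z = ≮⇒≥ z≮p
    q≤x : q ≤ x ⊎ q ∈ˢ (x ∷ points P) → q ≤ x
    q≤x (inj₁ q≤x)         = q≤x
    q≤x (inj₂ (here q≈x))  = inj₂ q≈x
    -- A later occurrence of `q` would place it at or beyond `z`, hence not below `p`.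
    q≤x (inj₂ (there q∈P)) = contradiction (≤-trans p≤z (start≤point P q∈P)) (<⇒≱ q<p)
    sum≈ft : f t * (step p z - step p x) + stieltjesSum f (step p) τ ≈ f t
    sum≈ft = begin
      f t * (step p z - step p x) + stieltjesSum f (step p) τ
        ≈⟨ +-cong (*-congˡ (+-cong (step≈1 p≤z) (-‿cong (step≈0 x<p)))) (stieltjesSum-step-≥ f p≤z τ) ⟩
      f t * (1# - 0#) + 0#   ≈⟨ +-identityʳ _ ⟩
      f t * (1# - 0#)        ≈⟨ *-congˡ (trans (+-congˡ -0#≈0#) (+-identityʳ 1#)) ⟩
      f t * 1#               ≈⟨ *-identityʳ _ ⟩
      f t                    ∎

  IsIntegral-step : ∀ {f} → f Preserves _≈_ ⟶ _≈_ → ∀ {p a b} → a < p → p ≤ b →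
                    LeftContinuousAt f p → IsIntegral f (step p) a b (f p)
  IsIntegral-step {f} f-cong {p} {a} {b} a<p p≤b f-left ε 0<ε = P , λ Q Q⊇P τ →
    stieltjesSum-step q<p near a<p p≤b (inj₂ (Q⊇P (there (here refl))))
      (Q⊇P (there (there (here refl)))) τ
    where
    δ = proj₁ (f-left ε 0<ε)
    0<δ = proj₁ (proj₂ (f-left ε 0<ε))
    0<δ½ = *-pos 0<δ 0<½
    p-δ<p-δ½ : p - δ < p - δ * ½
    p-δ<p-δ½ = <-respˡ-≈ (trans (+-assoc p _ _) (+-congˡ (trans (-‿+-comm _ _) (-‿cong (x½+x½≈x δ)))))
      (x-y<x 0<δ½)

    -- The cut is the larger of `a` and `p - δ * ½`. Halving `δ` makes `p - δ < q` strict, so that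
    -- the tag `t = q` is also covered by left continuity.
    cut : ∃ λ q → a ≤ q × q < p × p - δ < q
    cut with ≤-total a (p - δ * ½)
    ... | inj₁ a≤q = p - δ * ½ , a≤q , x-y<x 0<δ½ , p-δ<p-δ½
    ... | inj₂ q≤a = a , ≤-refl , a<p , <-≤-trans p-δ<p-δ½ q≤a

    q = proj₁ cut
    a≤q = proj₁ (proj₂ cut)
    q<p = proj₁ (proj₂ (proj₂ cut))
    p-δ<q = proj₂ (proj₂ (proj₂ cut))

    P : Partition a b
    P = a≤q ∷ inj₁ q<p ∷ p≤b ∷ [ refl ]

    near : ∀ t → q ≤ t → t ≤ p → ∣ f t - f p ∣ < ε
    near t q≤t (inj₁ t<p) = proj₂ (proj₂ (f-left ε 0<ε)) t (<-≤-trans p-δ<q q≤t) t<p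
    -- Left continuity speaks only of points strictly below `p`; a tag at `p` is handled by
    -- congruence.
    near t q≤t (inj₂ t≈p) = ∣∣<-0 (trans (+-congʳ (f-cong t≈p)) (-‿inverseʳ _)) 0<ε

  -- The integral part as a sum of unit jumps

  sumMap : (ℤ → Carrier) → List ℤ → Carrier
  sumMap h ns = foldr _+_ 0# (map h ns)

  IsIntegral-steps : ∀ {f a b} → a ≤ b → ∀ {ns} →
    All (λ n → IsIntegral f (step (fromℤ n)) a b (f (fromℤ n))) ns →
    IsIntegral f (λ u → sumMap (λ n → step (fromℤ n) u) ns) a b (sumMap (λ n → f (fromℤ n)) ns)
  IsIntegral-steps a≤b []        = IsIntegral-const 0# a≤b
  IsIntegral-steps a≤b (∫n ∷ ∫ns) = IsIntegral-+ ∫n (IsIntegral-steps a≤b ∫ns)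

  sumMap-filter : ∀ {p} {P : ℤ → Set p} (P? : Decidable P) (h : ℤ → Carrier) {ns} →
                  All (λ n → ¬ P n → h n ≈ 0#) ns → sumMap h (filter P? ns) ≈ sumMap h ns
  sumMap-filter P? h [] = refl
  sumMap-filter P? h {n ∷ _} (h≈0 ∷ hs) with P? n
  ... | yes _  = +-congˡ (sumMap-filter P? h hs)
  ... | no ¬Pn = trans (sumMap-filter P? h hs) (trans (sym (+-identityˡ _)) (+-congʳ (sym (h≈0 ¬Pn))))

  sum-indicator : ∀ (h : ℕ → Carrier) j m → j ℕ.≤ m →
                  (∀ k → k ℕ.< j → h k ≈ 1#) → (∀ k → j ℕ.≤ k → h k ≈ 0#) →
                  foldr _+_ 0# (applyUpTo h m) ≈ j · 1#
  sum-indicator h zero    zero    _         _  _  = refl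
  sum-indicator h zero    (suc m) _         h1 h0 = trans
    (+-cong (h0 0 ℕ.z≤n) (sum-indicator (λ k → h (suc k)) 0 m ℕ.z≤n (λ _ ()) (λ k _ → h0 (suc k) ℕ.z≤n)))
    (+-identityˡ 0#)
  sum-indicator h (suc j) (suc m) (s≤s j≤m) h1 h0 =
    +-cong (h1 0 (s≤s ℕ.z≤n)) (sum-indicator (λ k → h (suc k)) j m j≤m
      (λ k k<j → h1 (suc k) (s≤s k<j)) (λ k j≤k → h0 (suc k) (s≤s j≤k)))

  ⌊⌋-mono : ∀ {x y} → x ≤ y → ⌊ x ⌋ ℤ.≤ ⌊ y ⌋
  ⌊⌋-mono {x} x≤y = ≤⇒≤⌊⌋ (≤-trans (⌊⌋-lower x) x≤y)

  -- `⌊_⌋` is found by a search from Archimedean bounds, which need not respect `≈`. The results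
  -- still coincide, because monotonicity applies in both directions.
  ⌊⌋-cong : ∀ {x y} → x ≈ y → fromℤ ⌊ x ⌋ ≈ fromℤ ⌊ y ⌋
  ⌊⌋-cong x≈y = reflexive (≡.cong fromℤ (ℤ.≤-antisym (⌊⌋-mono (inj₂ x≈y)) (⌊⌋-mono (inj₂ (sym x≈y)))))

  -- The jump at `n` contributes `1#` exactly when `n ≤ x`, so the sum counts the integers from
  -- `⌊ a ⌋ + 1` to `⌊ x ⌋`.
  sum-steps : ∀ {a b x} → a ≤ x → x ≤ b →
              sumMap (λ n → step (fromℤ n) x) (integersIn a b) ≈ fromℤ ⌊ x ⌋ - fromℤ ⌊ a ⌋
  sum-steps {a} {b} {x} a≤x x≤b = begin
    sumMap h (integersIn a b)
      -- The first candidate is `⌊ a ⌋` itself, which is not above `a`; the remaining ones start at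
      -- `⌊ a ⌋ + 1`.
      ≡⟨ ≡.cong (sumMap h) (filter-reject (_∈⟨ a , b ]?) {xs = rest}
           (λ (a<z , _) → <⇒≱ a<z (≤-trans (inj₂ (reflexive (≡.cong fromℤ (ℤ.+-identityʳ z)))) (⌊⌋-lower a)))) ⟩
    sumMap h (filter (_∈⟨ a , b ]?) rest)
      -- The filter can now be dropped: the remaining candidates exceed `a`, so a rejected one
      -- cannot be at most `x ≤ b`, and its jump vanishes at `x`.
      ≈⟨ sumMap-filter (_∈⟨ a , b ]?) h (All.applyUpTo⁺₂ _ M outside) ⟩
    sumMap h rest
      ≡⟨ ≡.cong (foldr _+_ 0#) (map-applyUpTo (λ k → z ℤ.+ + suc k) h M) ⟩
    foldr _+_ 0# (applyUpTo (λ k → h (z ℤ.+ + suc k)) M)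
      -- Index `k` stands for the integer `z + k + 1`, which is at most `⌊ x ⌋ = z + j` exactly when
      -- `k < j`.
      ≈⟨ sum-indicator _ j M j≤M (λ k k<j → step≈1 (below k<j)) (λ k j≤k → step≈0 (above j≤k)) ⟩
    j · 1#
      ≈⟨ solve 2 (λ j z → j := (z :+ j) :- z) refl (j · 1#) (fromℤ z) ⟩
    (fromℤ z + fromℤ (+ j)) - fromℤ z
      ≈⟨ +-congʳ (fromℤ-+ z (+ j)) ⟨
    fromℤ (z ℤ.+ + j) - fromℤ z
      ≡⟨ ≡.cong (λ i → fromℤ i - fromℤ z) z+j≡⌊x⌋ ⟩
    fromℤ ⌊ x ⌋ - fromℤ z ∎
    where
    open SetoidReasoning setoid
    z = ⌊ a ⌋
    h : ℤ → Carrier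
    h n = step (fromℤ n) x
    M = ℤ.∣ ⌊ b ⌋ ℤ.- z ∣
    j = ℤ.∣ ⌊ x ⌋ ℤ.- z ∣
    rest = applyUpTo (λ k → z ℤ.+ + suc k) M

    z+j≡⌊x⌋ : z ℤ.+ + j ≡ ⌊ x ⌋
    z+j≡⌊x⌋ = ≤⇒+ℕ (⌊⌋-mono a≤x)

    cancel-≤ : ∀ {k l} → z ℤ.+ + k ℤ.≤ z ℤ.+ + l → k ℕ.≤ l
    cancel-≤ {k} {l} p = ℤ.drop‿+≤+ (≡.subst₂ ℤ._≤_ (shift k) (shift l) (ℤ.+-monoʳ-≤ (ℤ.- z) p))
      where
      shift : ∀ k → ℤ.- z ℤ.+ (z ℤ.+ + k) ≡ + k
      shift k = ≡.trans (≡.sym (ℤ.+-assoc (ℤ.- z) z (+ k)))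
        (≡.trans (≡.cong (ℤ._+ + k) (ℤ.+-inverseˡ z)) (ℤ.+-identityˡ (+ k)))

    j≤M : j ℕ.≤ M
    j≤M = cancel-≤ (≡.subst₂ ℤ._≤_ (≡.sym z+j≡⌊x⌋)
      (≡.sym (≤⇒+ℕ (⌊⌋-mono (≤-trans a≤x x≤b)))) (⌊⌋-mono x≤b))

    below : ∀ {k} → k ℕ.< j → fromℤ (z ℤ.+ + suc k) ≤ x
    below {k} k<j = ≤-trans (fromℤ-mono-≤ (≡.subst (z ℤ.+ + suc k ℤ.≤_) z+j≡⌊x⌋ (ℤ.+-monoʳ-≤ z (ℤ.+≤+ k<j))))
      (⌊⌋-lower x)

    above : ∀ {k} → j ℕ.≤ k → x < fromℤ (z ℤ.+ + suc k)
    above {k} j≤k with x <? fromℤ (z ℤ.+ + suc k)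
    ... | yes x<n = x<n
    ... | no  x≮n = contradiction
      (cancel-≤ (≡.subst (_ ℤ.≤_) (≡.sym z+j≡⌊x⌋) (≤⇒≤⌊⌋ (≮⇒≥ x≮n)))) (ℕ.≤⇒≯ j≤k)

    a<n : ∀ k → a < fromℤ (z ℤ.+ + suc k)
    a<n k = <-≤-trans (⌊⌋-upper a) (≤-trans (inj₂ (sym (fromℤ-suc z)))
      (fromℤ-mono-≤ (≡.subst (ℤ._≤ z ℤ.+ + suc k) (ℤ.+-comm z (+ 1))
        (ℤ.+-monoʳ-≤ z (ℤ.+≤+ (s≤s ℕ.z≤n))))))

    outside : ∀ k → ¬ (z ℤ.+ + suc k) ∈⟨ a , b ] → h (z ℤ.+ + suc k) ≈ 0#
    outside k ∉ with fromℤ (z ℤ.+ + suc k) ≤? x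
    ... | yes n≤x = contradiction (a<n k , ≤-trans n≤x x≤b) ∉
    ... | no  _   = refl

  -- By `sum-steps` the integral part differs on `[a, b]` from a finite sum of unit jumps by the
  -- constant `fromℤ ⌊ a ⌋`, and each jump at `n` contributes `f (fromℤ n)`.
  IsIntegral-⌊⌋ : ∀ {f} → f Preserves _≈_ ⟶ _≈_ → ∀ {a b} → a ≤ b →
    (∀ (n : ℤ) → a < fromℤ n → fromℤ n ≤ b → LeftContinuousAt f (fromℤ n)) →
    IsIntegral f (λ u → fromℤ ⌊ u ⌋) a b (∑[ a < n ≤ b ] f n)
  IsIntegral-⌊⌋ f-cong {a} {b} a≤b f-left = IsIntegral-resp same refl
    (IsIntegral-steps a≤b (All.tabulate λ {n} n∈ →
      let (a<n , n≤b) = Equivalence.to (∈-integersIn a b n) n∈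
      in IsIntegral-step f-cong a<n n≤b (f-left n a<n n≤b)))
    where
    same : SameIncrements (λ u → sumMap (λ n → step (fromℤ n) u) (integersIn a b))
                          (λ u → fromℤ ⌊ u ⌋) a b
    same {x} {y} a≤x x≤y y≤b = trans
      (+-cong (sum-steps (≤-trans a≤x x≤y) y≤b) (-‿cong (sum-steps a≤x (≤-trans x≤y y≤b))))
      (solve 3 (λ x y a → (y :- a) :- (x :- a) := y :- x) refl
        (fromℤ ⌊ x ⌋) (fromℤ ⌊ y ⌋) (fromℤ ⌊ a ⌋))

  -- Integration against the sawtooth function, and the summation formula

  IsIntegral-sawtooth : ∀ {f} → f Preserves _≈_ ⟶ _≈_ → ∀ {a b I} → a ≤ b →
    IsIntegral f (λ u → u) a b I →
    (∀ (n : ℤ) → a < fromℤ n → fromℤ n ≤ b → LeftContinuousAt f (fromℤ n)) →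
    IsIntegral f (λ u → u - fromℤ ⌊ u ⌋ - ½) a b (I - ∑[ a < n ≤ b ] f n)
  -- The integrator is literally the sum of the three pieces; only the `0#` contributed by the
  -- constant `- ½` has to be removed from the value.
  IsIntegral-sawtooth f-cong a≤b ∫f f-left = IsIntegral-resp (λ _ _ _ → refl) (+-identityʳ _)
    (IsIntegral-+ (IsIntegral-+ ∫f (IsIntegral-neg (IsIntegral-⌊⌋ f-cong a≤b f-left)))
      (IsIntegral-const (- ½) a≤b))

  sawtooth-cong : (λ u → u - fromℤ ⌊ u ⌋ - ½) Preserves _≈_ ⟶ _≈_
  sawtooth-cong x≈y = +-congʳ (+-cong x≈y (-‿cong (⌊⌋-cong x≈y)))

corollary1 :
    ∀ {c ℓ₁ ℓ₂} (R : RealField c ℓ₁ ℓ₂) →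
    let open RealField R
        open RealAnalysis R
    in
    (a b : Carrier) → a ≤ b →
    (f : Carrier → Carrier) → f Preserves _≈_ ⟶ _≈_ →
    (f-integrable : RiemannIntegrable f a b) →
    (∀ (n : ℤ) → a < fromℤ n → fromℤ n ≤ b → LeftContinuousAt f (fromℤ n)) →
    Σ[ df-integrable ∈ RiemannStieltjesIntegrable (λ u → u - fromℤ ⌊ u ⌋ - ½) f a b ]
      ∑[ a < n ≤ b ] f n
        ≈ ∫ f-integrable + ∫ df-integrable
          + f a * (a - fromℤ ⌊ a ⌋ - ½) - f b * (b - fromℤ ⌊ b ⌋ - ½)
corollary1 R a b a≤b f f-cong (I , ∫f) f-left =
  -- The value left to inference is the boundary term minus `I - s`, where `s` is the sum over
  -- integers. Substituting it turns the formula into a ring identity.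
  (_ , IsIntegral-parts f-cong sawtooth-cong (IsIntegral-sawtooth f-cong a≤b ∫f f-left)) ,
  solve 4 (λ s i fb fa → s := ((i :+ ((fb :- fa) :- (i :- s))) :+ fa) :- fb) refl
    (∑[ a < n ≤ b ] f n) I (f b * (b - fromℤ ⌊ b ⌋ - ½)) (f a * (a - fromℤ ⌊ a ⌋ - ½))
  where
  open RealField R
  open RealAnalysis R
  open EulerSummation R
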